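{- Let $L=(\mathcal L,\mathrm{Act})$ be a signature with deterministic assignments. Any formula of the first-order modal $\mu$-calculus is equivalent over assignment structures to one with only two propositional variables: for every $L\mu$-formula $\psi$ there is an $L\mu$-formula $\psi'$ in which at most two distinct propositional variables occur such that $\mathfrak A[\![\psi]\!]_\mu=\mathfrak A[\![\psi']\!]_\mu$ for every $L$-assignment structure $\mathfrak A$ (under the standing convention on control variables stated in the context).
   Context: A signature $L=(\mathcal L,\mathrm{Act})$ is a first-order signature $\mathcal L$ together with a set $\mathrm{Act}$ of transition symbols. Fix an infinite set $\mathcal X$ of object variables and a collection $\mathcal V$ of propositional variables; each $X\in\mathcal V$ has a fresh complement $\overline X\notin\mathcal V$, $\overline{\overline X}=X$, $\overline{\mathcal V}=\mathcal V\cup\{\overline X:X\in\mathcal V\}$. A literal is an atomic first-order $\mathcal L$-formula (with equality) over $\mathcal X$ or the negation of one. $L$-structure $\mathfrak A$: an $\mathcal L$-structure with domain $|\mathfrak A|$, with a relation $\mathfrak A[\![a]\!]\subseteq\mathcal S\times\mathcal S$ for each $a\in\mathrm{Act}$, where $\mathcal S$ is the set of states $\omega:\mathcal X\to|\mathfrak A|$. The state $\omega[x\mapsto e]$ is $\omega$ with the value at $x$ changed to $e$, and $\omega[\![\theta]\!]$ is the value of the term $\theta$ in state $\omega$. A valuation is a map $\Omega:\mathcal V\to\mathcal P(\mathcal S)$, extended by $\Omega(\overline X)=\mathcal S\setminus\Omega(X)$; $\Omega[X\mapsto E]$ gives $X\in\overline{\mathcal V}$ the value $E$ (and $\overline X$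 the value $\mathcal S\setminus E$) and otherwise agrees with $\Omega$. $L\mu[\mathcal V]$-formulas: $\varphi::=p\mid X\mid\varphi\lor\varphi\mid\varphi\land\varphi\mid\langle a\rangle\varphi\mid[a]\varphi\mid\mu X.\psi\mid\nu X.\psi$ with $p$ a literal, $X\in\overline{\mathcal V}$, $a\in\mathrm{Act}$, and $\psi$ a formula not mentioning $\overline X$. $L\mu$-formulas are those without free propositional variables. Semantics: $\Omega[\![p]\!]_\mu$ is the set of states satisfying $p$; $\Omega[\![X]\!]_\mu=\Omega(X)$; $\lor,\land$ are interpreted as $\cup,\cap$; $\Omega[\![\langle a\rangle\varphi]\!]_\mu=\{\omega:\exists(\omega,\omega')\in\mathfrak A[\![a]\!],\ \omega'\in\Omega[\![\varphi]\!]_\mu\}$; $\Omega[\![[a]\varphi]\!]_\mu=\{\omega:\forall(\omega,\omega')\in\mathfrak A[\![a]\!],\ \omega'\in\Omega[\![\varphi]\!]_\mu\}$; $\Omega[\![\mu X.\varphi]\!]_\mu=\bigcap\{D\subseteq\mathcal S:\Omega[X\mapsto D][\![\varphi]\!]_\mu\subseteq D\}$; $\Omega[\![\nu X.\varphi]\!]_\mu=\bigcup\{D\subseteq\mathcal S:D\subseteq\Omega[X\mapsto D][\![\varphi]\!]_\mu\}$. For $L\mu$-formulas this is independent of $\Omega$ and written $\mathfrak A[\![\varphi]\!]_\mu$. $L$ has deterministic assignments if $\mathcal L$ contains at least two distinct constant symbols $0,1$ and $(x:=\theta)\in\mathrm{Act}$ for every $x\in\mathcal X$ and every $\mathcal L$-term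 $\theta$. For such $L$, an $L$-structure is an assignment structure if $0^{\mathfrak A}\ne1^{\mathfrak A}$ and $\mathfrak A[\![x:=\theta]\!]=\{(\omega,\omega[x\mapsto\omega[\![\theta]\!]]):\omega\in\mathcal S\}$ for all $x,\theta$. No further constant symbols and no further distinct elements are required. Standing convention (control variables): an object variable $y$ is independent of a transition symbol $a$ if $(\omega,\omega')\in\mathfrak A[\![a]\!]$ implies $(\omega[y\mapsto b],\omega'[y\mapsto b])\in\mathfrak A[\![a]\!]$ for all $b\in|\mathfrak A|$. For the given $\psi$ and the assignment structures considered, it is assumed that fresh control variables are available, that is, object variables not occurring in $\psi$ and independent of every transition symbol occurring in $\psi$. A single control variable is enough if $\mathcal L$ happens to have pairwise distinctly interpreted constants, one for each propositional variable or complement occurring in $\psi$; otherwise one control variable $x_X$ for each such $X$ is used, taking only the values $0$ and $1$. -}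

module Defs where

open import Axiom.ExcludedMiddle using (ExcludedMiddle)
open import Data.Bool.Base as Bool using (Bool; T; not; if_then_else_)
open import Data.List.Base using (List; length)
open import Data.List.Membership.Propositional using (_∈_; _∉_)
open import Data.Nat.Base using (ℕ; _≤_)
open import Data.Product.Base using (_×_; _,_; ∃; ∃-syntax; ∃₂)
open import Data.Sum.Base using (_⊎_)
open import Data.Empty using (⊥)
open import Data.Vec.Base using (Vec; []; _∷_)
open import Data.Vec.Relation.Unary.Any using (Any)
open import Function.Base using (_∘_)
open import Function.Bundles using (_⇔_)
open import Level using (0ℓ)
open import Relation.Binary.Core using (Rel)
open import Relation.Binary.PropositionalEquality.Core using (_≡_; _≢_)
open import Relation.Nullary.Decidable.Core using (does)
open import Relation.Nullary.Negation.Core using (¬_)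
open import Relation.Unary using (Pred)

Infinite : Set → Set
Infinite A = (xs : List A) → ∃[ x ] x ∉ xs

------------------------------------------------------------------------
-- Syntax

-- Constant symbols are the elements of Func 0.
record Signature : Set₁ where
  field
    Func     : ℕ → Set
    Relation : ℕ → Set
    Act      : Set

module _ (L : Signature) (𝒳 : Set) where
  open Signature L

  data Term : Set where
    var : 𝒳 → Term
    app : ∀ {n} → Func n → Vec Term n → Term

  data Atom : Set where
    rel : ∀ {n} → Relation n → Vec Term n → Atom
    _≈_ : Term → Term → Atom

  data Literal : Set where
    pos neg : Atom → Literal

  -- The injectivity field says that the x ≔ θ are pairwise distinct symbols,
  -- so that Act literally contains a copy of the set of all assignments.
  record DeterministicAssignments : Set where
    infix 6 _≔_
    field
      𝟎 𝟏         : Func 0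
      𝟎≢𝟏         : 𝟎 ≢ 𝟏
      _≔_         : 𝒳 → Term → Act
      ≔-injective : ∀ {x y θ η} → x ≔ θ ≡ y ≔ η → x ≡ y × θ ≡ η

-- The set of propositional variables 𝒱 together with their complements.
data PVar (𝒱 : Set) : Set where
  plain compl : 𝒱 → PVar 𝒱

complement : {𝒱 : Set} → PVar 𝒱 → PVar 𝒱
complement (plain X) = compl X
complement (compl X) = plain X

-- Raw formulas; the side condition on fixpoint binders is WellFormed below.
data Formula (L : Signature) (𝒳 𝒱 : Set) : Set where
  lit         : Literal L 𝒳 → Formula L 𝒳 𝒱
  pvar        : PVar 𝒱 → Formula L 𝒳 𝒱
  _∨_ _∧_     : Formula L 𝒳 𝒱 → Formula L 𝒳 𝒱 → Formula L 𝒳 𝒱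
  ⟨_⟩_ [_]_   : Signature.Act L → Formula L 𝒳 𝒱 → Formula L 𝒳 𝒱
  μ_∙_ ν_∙_   : PVar 𝒱 → Formula L 𝒳 𝒱 → Formula L 𝒳 𝒱

module _ {L : Signature} {𝒳 𝒱 : Set} where
  open Signature L

  -- Any occurrence counts, whether free, bound or at a binder.
  _mentionedIn_ : PVar 𝒱 → Formula L 𝒳 𝒱 → Set
  X mentionedIn lit p     = ⊥
  X mentionedIn pvar Y    = X ≡ Y
  X mentionedIn (φ ∨ χ)   = X mentionedIn φ ⊎ X mentionedIn χ
  X mentionedIn (φ ∧ χ)   = X mentionedIn φ ⊎ X mentionedIn χ
  X mentionedIn (⟨ a ⟩ φ) = X mentionedIn φ
  X mentionedIn ([ a ] φ) = X mentionedIn φ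
  X mentionedIn (μ Y ∙ φ) = X ≡ Y ⊎ X mentionedIn φ
  X mentionedIn (ν Y ∙ φ) = X ≡ Y ⊎ X mentionedIn φ

  _freeIn_ : PVar 𝒱 → Formula L 𝒳 𝒱 → Set
  X freeIn lit p     = ⊥
  X freeIn pvar Y    = X ≡ Y
  X freeIn (φ ∨ χ)   = X freeIn φ ⊎ X freeIn χ
  X freeIn (φ ∧ χ)   = X freeIn φ ⊎ X freeIn χ
  X freeIn (⟨ a ⟩ φ) = X freeIn φ
  X freeIn ([ a ] φ) = X freeIn φ
  X freeIn (μ Y ∙ φ) = X ≢ Y × X freeIn φ
  X freeIn (ν Y ∙ φ) = X ≢ Y × X freeIn φ

  data WellFormed : Formula L 𝒳 𝒱 → Set where
    lit  : ∀ p → WellFormed (lit p)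
    pvar : ∀ X → WellFormed (pvar X)
    _∨_  : ∀ {φ χ} → WellFormed φ → WellFormed χ → WellFormed (φ ∨ χ)
    _∧_  : ∀ {φ χ} → WellFormed φ → WellFormed χ → WellFormed (φ ∧ χ)
    ⟨_⟩_ : ∀ a {φ} → WellFormed φ → WellFormed (⟨ a ⟩ φ)
    [_]_ : ∀ a {φ} → WellFormed φ → WellFormed ([ a ] φ)
    μ    : ∀ {X φ} → ¬ complement X mentionedIn φ → WellFormed φ →
           WellFormed (μ X ∙ φ)
    ν    : ∀ {X φ} → ¬ complement X mentionedIn φ → WellFormed φ →
           WellFormed (ν X ∙ φ)

  IsLμFormula : Formula L 𝒳 𝒱 → Set
  IsLμFormula φ = WellFormed φ × (∀ X → ¬ X freeIn φ)

  -- X and its complement are counted as two distinct variables here, so this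
  -- is the stricter of the two possible ways of counting.
  AtMostTwoPVars : Formula L 𝒳 𝒱 → Set
  AtMostTwoPVars φ =
    ∃[ Xs ] length Xs ≤ 2 × (∀ (X : PVar 𝒱) → X mentionedIn φ → X ∈ Xs)

  _actionOf_ : Act → Formula L 𝒳 𝒱 → Set
  a actionOf lit p     = ⊥
  a actionOf pvar X    = ⊥
  a actionOf (φ ∨ χ)   = a actionOf φ ⊎ a actionOf χ
  a actionOf (φ ∧ χ)   = a actionOf φ ⊎ a actionOf χ
  a actionOf (⟨ b ⟩ φ) = a ≡ b ⊎ a actionOf φ
  a actionOf ([ b ] φ) = a ≡ b ⊎ a actionOf φ
  a actionOf (μ X ∙ φ) = a actionOf φ
  a actionOf (ν X ∙ φ) = a actionOf φ

module _ {L : Signature} {𝒳 : Set} where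

  data _inTerm_ (y : 𝒳) : Term L 𝒳 → Set where
    var : y inTerm var y
    app : ∀ {n} {f : Signature.Func L n} {θs} →
          Any (y inTerm_) θs → y inTerm app f θs

  _inAtom_ : 𝒳 → Atom L 𝒳 → Set
  y inAtom rel R θs = Any (y inTerm_) θs
  y inAtom (θ ≈ η)  = y inTerm θ ⊎ y inTerm η

  _inLiteral_ : 𝒳 → Literal L 𝒳 → Set
  y inLiteral pos α = y inAtom α
  y inLiteral neg α = y inAtom α

module _ {L : Signature} {𝒳 𝒱 : Set} (da : DeterministicAssignments L 𝒳) where
  open Signature L
  open DeterministicAssignments da

  -- Assignments are the only transition symbols with syntactic structure.
  _inAct_ : 𝒳 → Act → Set
  y inAct a = ∃₂ λ x θ → a ≡ x ≔ θ × (y ≡ x ⊎ y inTerm θ)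

  _inFormula_ : 𝒳 → Formula L 𝒳 𝒱 → Set
  y inFormula lit p     = y inLiteral p
  y inFormula pvar X    = ⊥
  y inFormula (φ ∨ χ)   = y inFormula φ ⊎ y inFormula χ
  y inFormula (φ ∧ χ)   = y inFormula φ ⊎ y inFormula χ
  y inFormula (⟨ a ⟩ φ) = y inAct a ⊎ y inFormula φ
  y inFormula ([ a ] φ) = y inAct a ⊎ y inFormula φ
  y inFormula (μ X ∙ φ) = y inFormula φ
  y inFormula (ν X ∙ φ) = y inFormula φ

  -- The syntactic part of the convention on control variables.  The two
  -- functions are total for convenience; only their values at variables
  -- mentioned in ψ matter.
  data Controls (ψ : Formula L 𝒳 𝒱) : Set where
    single : (y : 𝒳) → ¬ y inFormula ψ → (c : PVar 𝒱 → Func 0) → Controls ψ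
    family : (x : PVar 𝒱 → 𝒳) →
             (∀ X → X mentionedIn ψ → ¬ x X inFormula ψ) →
             (∀ X Y → X mentionedIn ψ → Y mentionedIn ψ → x X ≡ x Y → X ≡ Y) →
             Controls ψ

------------------------------------------------------------------------
-- Structures

record Structure (L : Signature) (𝒳 : Set) : Set₁ where
  open Signature L
  field
    ∣_∣   : Set
  State : Set
  State = 𝒳 → ∣_∣
  field
    funcᴵ : ∀ {n} → Func n → Vec ∣_∣ n → ∣_∣
    relᴵ  : ∀ {n} → Relation n → Pred (Vec ∣_∣ n) 0ℓ
    actᴵ  : Act → Rel State 0ℓ

  mutual
    value : State → Term L 𝒳 → ∣_∣
    value ω (var x)    = ω x
    value ω (app f θs) = funcᴵ f (values ω θs)

    values : State → ∀ {n} → Vec (Term L 𝒳) n → Vec ∣_∣ n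
    values ω []       = []
    values ω (θ ∷ θs) = value ω θ ∷ values ω θs

  _⊨ᵃ_ : State → Atom L 𝒳 → Set
  ω ⊨ᵃ rel R θs = relᴵ R (values ω θs)
  ω ⊨ᵃ (θ ≈ η)  = value ω θ ≡ value ω η

  _⊨_ : State → Literal L 𝒳 → Set
  ω ⊨ pos α = ω ⊨ᵃ α
  ω ⊨ neg α = ¬ ω ⊨ᵃ α

-- The classical powerset.  With Pred in place of Bool the fixpoint clauses
-- would quantify over subsets impredicatively and leave the universe; under
-- excluded middle every Pred A 0ℓ has a characteristic function.
𝒫 : Set → Set
𝒫 A = A → Bool

infix 4 _∈ₛ_ _⊆ₛ_

_∈ₛ_ : {A : Set} → A → 𝒫 A → Set
a ∈ₛ D = T (D a)

_⊆ₛ_ : {A : Set} → 𝒫 A → 𝒫 A → Set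
D ⊆ₛ E = ∀ a → a ∈ₛ D → a ∈ₛ E

∁ : {A : Set} → 𝒫 A → 𝒫 A
∁ D = not ∘ D

------------------------------------------------------------------------
-- Semantics, in a classical metatheory

module Semantics (em : ExcludedMiddle 0ℓ) where

  ⟪_⟫ : {A : Set} → Pred A 0ℓ → 𝒫 A
  ⟪ P ⟫ a = does (em {P a})

  _[_↦_] : {A B : Set} → (A → B) → A → B → (A → B)
  (f [ x ↦ b ]) y = if does (em {y ≡ x}) then b else f y

  module _ {L : Signature} {𝒳 𝒱 : Set} (𝔄 : Structure L 𝒳) where
    open Structure 𝔄

    Valuation : Set
    Valuation = 𝒱 → 𝒫 State

    extend : Valuation → PVar 𝒱 → 𝒫 State
    extend Ω (plain X) = Ω X
    extend Ω (compl X) = ∁ (Ω X)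

    updateᵛ : Valuation → PVar 𝒱 → 𝒫 State → Valuation
    updateᵛ Ω (plain X) E = Ω [ X ↦ E ]
    updateᵛ Ω (compl X) E = Ω [ X ↦ ∁ E ]

    ⟦_⟧μ : Formula L 𝒳 𝒱 → Valuation → 𝒫 State
    ⟦ lit p ⟧μ     Ω = ⟪ (λ ω → ω ⊨ p) ⟫
    ⟦ pvar X ⟧μ    Ω = extend Ω X
    ⟦ φ ∨ χ ⟧μ     Ω = λ ω → ⟦ φ ⟧μ Ω ω Bool.∨ ⟦ χ ⟧μ Ω ω
    ⟦ φ ∧ χ ⟧μ     Ω = λ ω → ⟦ φ ⟧μ Ω ω Bool.∧ ⟦ χ ⟧μ Ω ω
    ⟦ ⟨ a ⟩ φ ⟧μ   Ω = ⟪ (λ ω → ∃[ ω′ ] actᴵ a ω ω′ × ω′ ∈ₛ ⟦ φ ⟧μ Ω) ⟫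
    ⟦ [ a ] φ ⟧μ   Ω = ⟪ (λ ω → ∀ ω′ → actᴵ a ω ω′ → ω′ ∈ₛ ⟦ φ ⟧μ Ω) ⟫
    ⟦ μ X ∙ φ ⟧μ   Ω =
      ⟪ (λ ω → ∀ (D : 𝒫 State) → ⟦ φ ⟧μ (updateᵛ Ω X D) ⊆ₛ D → ω ∈ₛ D) ⟫
    ⟦ ν X ∙ φ ⟧μ   Ω =
      ⟪ (λ ω → ∃[ D ] D ⊆ₛ ⟦ φ ⟧μ (updateᵛ Ω X D) × ω ∈ₛ D) ⟫

  module _ {L : Signature} {𝒳 : Set} (𝔄 : Structure L 𝒳) where
    open Signature L
    open Structure 𝔄

    IsAssignmentStructure : DeterministicAssignments L 𝒳 → Set
    IsAssignmentStructure da =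
      funcᴵ 𝟎 [] ≢ funcᴵ 𝟏 [] ×
      (∀ x θ ω ω′ → actᴵ (x ≔ θ) ω ω′ ⇔ ω′ ≡ ω [ x ↦ value ω θ ])
      where open DeterministicAssignments da

    Independent : 𝒳 → Act → Set
    Independent y a =
      ∀ {ω ω′} → actᴵ a ω ω′ → ∀ b → actᴵ a (ω [ y ↦ b ]) (ω′ [ y ↦ b ])

    -- The semantic part of the convention on control variables.
    ControlsAvailable : {𝒱 : Set} {da : DeterministicAssignments L 𝒳}
                        {ψ : Formula L 𝒳 𝒱} → Controls da ψ → Set
    ControlsAvailable {ψ = ψ} (single y _ c) =
      (∀ a → a actionOf ψ → Independent y a) ×
      (∀ X Y → X mentionedIn ψ → Y mentionedIn ψ → X ≢ Y →
        funcᴵ (c X) [] ≢ funcᴵ (c Y) [])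
    ControlsAvailable {ψ = ψ} (family x _ _) =
      ∀ X → X mentionedIn ψ → ∀ a → a actionOf ψ → Independent (x X) a

{-# OPTIONS --safe #-}

-- A valuation of the propositional variables of ψ is packed into a single set
-- of states E by letting the control variables name the variable meant: ω
-- belongs to Z iff the state ω with the control variables set to the code of Z
-- belongs to E.  Binding Z changes the packed set only at codes of Z, so if U
-- holds the packed valuation outside μ Z ∙ φ then the one inside is the least
-- V satisfying V = (at a code of Z: φ, elsewhere: U).  Inside φ the old pack is
-- no longer needed, so U is free to be bound by the next fixpoint.
module Submission where

open import Axiom.ExcludedMiddle using (ExcludedMiddle)
open import Axiom.Extensionality.Propositional using (Extensionality)
open import Data.Bool.Base as Bool using (true; false; T; if_then_else_)
open import Data.Bool.Properties using (not-involutive; T-∧; T-∨; ∨-identityʳ)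
open import Data.Empty using (⊥-elim)
open import Data.List.Base using (List; []; _∷_; _++_; map)
open import Data.List.Membership.Propositional using (_∈_; _∉_)
open import Data.List.Membership.Propositional.Properties
  using (∈-++⁺ˡ; ∈-++⁺ʳ; ∈-++⁻; ∈-map⁺; ∈-map⁻)
open import Data.List.Relation.Unary.Any using (here; there)
open import Data.Nat.Base using (z≤n; s≤s)
open import Data.Product.Base using (_×_; _,_; proj₁; proj₂; ∃-syntax; ∃₂)
open import Data.Sum.Base as Sum using (_⊎_; inj₁; inj₂)
open import Data.Unit.Base using (⊤; tt)
open import Data.Vec.Base using (Vec; []; _∷_)
open import Data.Vec.Relation.Unary.Any using (Any; here; there)
open import Function.Base using (_∘_; id; case_of_)
open import Function.Bundles using (Equivalence)
open import Level using (0ℓ)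
open import Relation.Binary.Core using (Rel)
open import Relation.Binary.PropositionalEquality
  using (_≡_; _≢_; refl; sym; trans; cong; cong₂; subst; ≢-sym)
open import Relation.Nullary.Decidable.Core using (yes; no; does)
open import Relation.Nullary.Negation.Core using (¬_; contradiction)
open import Relation.Unary using (Pred)
open import Defs

-- Occurrences of propositional variables.

module _ {L : Signature} {𝒳 𝒱 : Set} where

  freeIn⇒mentionedIn : ∀ {X} (φ : Formula L 𝒳 𝒱) → X freeIn φ → X mentionedIn φ
  freeIn⇒mentionedIn (pvar Y)  eq       = eq
  freeIn⇒mentionedIn (φ ∨ χ)   (inj₁ f) = inj₁ (freeIn⇒mentionedIn φ f)
  freeIn⇒mentionedIn (φ ∨ χ)   (inj₂ f) = inj₂ (freeIn⇒mentionedIn χ f)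
  freeIn⇒mentionedIn (φ ∧ χ)   (inj₁ f) = inj₁ (freeIn⇒mentionedIn φ f)
  freeIn⇒mentionedIn (φ ∧ χ)   (inj₂ f) = inj₂ (freeIn⇒mentionedIn χ f)
  freeIn⇒mentionedIn (⟨ a ⟩ φ) f        = freeIn⇒mentionedIn φ f
  freeIn⇒mentionedIn ([ a ] φ) f        = freeIn⇒mentionedIn φ f
  freeIn⇒mentionedIn (μ Y ∙ φ) (_ , f)  = inj₂ (freeIn⇒mentionedIn φ f)
  freeIn⇒mentionedIn (ν Y ∙ φ) (_ , f)  = inj₂ (freeIn⇒mentionedIn φ f)

  pvars : Formula L 𝒳 𝒱 → List (PVar 𝒱)
  pvars (lit p)   = []
  pvars (pvar X)  = X ∷ []
  pvars (φ ∨ χ)   = pvars φ ++ pvars χ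
  pvars (φ ∧ χ)   = pvars φ ++ pvars χ
  pvars (⟨ a ⟩ φ) = pvars φ
  pvars ([ a ] φ) = pvars φ
  pvars (μ X ∙ φ) = X ∷ pvars φ
  pvars (ν X ∙ φ) = X ∷ pvars φ

  mentionedIn⇒∈pvars : ∀ {X} φ → X mentionedIn φ → X ∈ pvars φ
  mentionedIn⇒∈pvars (pvar Y)  refl        = here refl
  mentionedIn⇒∈pvars (φ ∨ χ)   (inj₁ m)    = ∈-++⁺ˡ (mentionedIn⇒∈pvars φ m)
  mentionedIn⇒∈pvars (φ ∨ χ)   (inj₂ m)    = ∈-++⁺ʳ (pvars φ) (mentionedIn⇒∈pvars χ m)
  mentionedIn⇒∈pvars (φ ∧ χ)   (inj₁ m)    = ∈-++⁺ˡ (mentionedIn⇒∈pvars φ m)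
  mentionedIn⇒∈pvars (φ ∧ χ)   (inj₂ m)    = ∈-++⁺ʳ (pvars φ) (mentionedIn⇒∈pvars χ m)
  mentionedIn⇒∈pvars (⟨ a ⟩ φ) m           = mentionedIn⇒∈pvars φ m
  mentionedIn⇒∈pvars ([ a ] φ) m           = mentionedIn⇒∈pvars φ m
  mentionedIn⇒∈pvars (μ Y ∙ φ) (inj₁ refl) = here refl
  mentionedIn⇒∈pvars (μ Y ∙ φ) (inj₂ m)    = there (mentionedIn⇒∈pvars φ m)
  mentionedIn⇒∈pvars (ν Y ∙ φ) (inj₁ refl) = here refl
  mentionedIn⇒∈pvars (ν Y ∙ φ) (inj₂ m)    = there (mentionedIn⇒∈pvars φ m)

  ∈pvars⇒mentionedIn : ∀ {X} φ → X ∈ pvars φ → X mentionedIn φ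
  ∈pvars⇒mentionedIn (pvar Y)  (here eq)  = eq
  ∈pvars⇒mentionedIn (φ ∨ χ)   i          =
    Sum.map (∈pvars⇒mentionedIn φ) (∈pvars⇒mentionedIn χ) (∈-++⁻ (pvars φ) i)
  ∈pvars⇒mentionedIn (φ ∧ χ)   i          =
    Sum.map (∈pvars⇒mentionedIn φ) (∈pvars⇒mentionedIn χ) (∈-++⁻ (pvars φ) i)
  ∈pvars⇒mentionedIn (⟨ a ⟩ φ) i          = ∈pvars⇒mentionedIn φ i
  ∈pvars⇒mentionedIn ([ a ] φ) i          = ∈pvars⇒mentionedIn φ i
  ∈pvars⇒mentionedIn (μ Y ∙ φ) (here eq)  = inj₁ eq
  ∈pvars⇒mentionedIn (μ Y ∙ φ) (there i)  = inj₂ (∈pvars⇒mentionedIn φ i)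
  ∈pvars⇒mentionedIn (ν Y ∙ φ) (here eq)  = inj₁ eq
  ∈pvars⇒mentionedIn (ν Y ∙ φ) (there i)  = inj₂ (∈pvars⇒mentionedIn φ i)

-- The common form of both kinds of control variables: the code of X gives the
-- control variable y the value bit X y, and the value of pivot X alone tells
-- the code of X from those of the other variables of ψ.
record Coding {L : Signature} {𝒳 𝒱 : Set} (da : DeterministicAssignments L 𝒳)
              (ψ : Formula L 𝒳 𝒱) : Set where
  field
    controls : List 𝒳
    pivot    : PVar 𝒱 → 𝒳
    bit      : PVar 𝒱 → 𝒳 → Signature.Func L 0
    fresh    : ∀ {y} → y ∈ controls → ¬ _inFormula_ da y ψ
    pivot∈   : ∀ {X} → X mentionedIn ψ → pivot X ∈ controls

-- The translation and its syntactic properties.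

module Translation {L : Signature} {𝒳 𝒱 : Set} (da : DeterministicAssignments L 𝒳)
                   {ψ : Formula L 𝒳 𝒱} (κ : Coding da ψ) where
  open Signature L
  open DeterministicAssignments da
  open Coding κ

  assign : List 𝒳 → (𝒳 → Func 0) → Formula L 𝒳 𝒱 → Formula L 𝒳 𝒱
  assign []       f χ = χ
  assign (y ∷ ys) f χ = ⟨ y ≔ app (f y) [] ⟩ assign ys f χ

  at : PVar 𝒱 → Formula L 𝒳 𝒱 → Formula L 𝒳 𝒱
  at X χ = assign controls (bit X) χ

  test : PVar 𝒱 → Atom L 𝒳
  test X = var (pivot X) ≈ app (bit X (pivot X)) []

  -- "If `test X` then `χ` else `U`" in negation normal form: only the literal is negated, so
  -- propositional variables keep positive polarity.
  repack : PVar 𝒱 → 𝒱 → Formula L 𝒳 𝒱 → Formula L 𝒳 𝒱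
  repack X U χ = (lit (pos (test X)) ∧ χ) ∨ (lit (neg (test X)) ∧ pvar (plain U))

  -- `U` holds the current pack and `V` is the spare variable; the two exchange roles under each
  -- binder.
  translate : 𝒱 → 𝒱 → Formula L 𝒳 𝒱 → Formula L 𝒳 𝒱
  translate U V (lit p)   = lit p
  translate U V (pvar X)  = at X (pvar (plain U))
  translate U V (φ ∨ χ)   = translate U V φ ∨ translate U V χ
  translate U V (φ ∧ χ)   = translate U V φ ∧ translate U V χ
  translate U V (⟨ a ⟩ φ) = ⟨ a ⟩ translate U V φ
  translate U V ([ a ] φ) = [ a ] translate U V φ
  translate U V (μ X ∙ φ) = at X (μ plain V ∙ repack X U (translate V U φ))
  translate U V (ν X ∙ φ) = at X (ν plain V ∙ repack X U (translate V U φ))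

  mentionedIn-assign : ∀ {X} ys f {χ} → X mentionedIn assign ys f χ → X mentionedIn χ
  mentionedIn-assign []       f m = m
  mentionedIn-assign (y ∷ ys) f m = mentionedIn-assign ys f m

  freeIn-assign : ∀ {X} ys f {χ} → X freeIn assign ys f χ → X freeIn χ
  freeIn-assign []       f m = m
  freeIn-assign (y ∷ ys) f m = freeIn-assign ys f m

  wellFormed-assign : ∀ ys f {χ} → WellFormed χ → WellFormed (assign ys f χ)
  wellFormed-assign []       f w = w
  wellFormed-assign (y ∷ ys) f w = ⟨ _ ⟩ wellFormed-assign ys f w

  mentionedIn-translate : ∀ {X U V} φ → X mentionedIn translate U V φ →
                          X ≡ plain U ⊎ X ≡ plain V
  mentionedIn-repack : ∀ {X U V} Z φ → X ≡ plain V ⊎ X mentionedIn repack Z U (translate V U φ) →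
                       X ≡ plain U ⊎ X ≡ plain V
  mentionedIn-translate (pvar Y)  m        = inj₁ (mentionedIn-assign controls (bit Y) m)
  mentionedIn-translate (φ ∨ χ)   (inj₁ m) = mentionedIn-translate φ m
  mentionedIn-translate (φ ∨ χ)   (inj₂ m) = mentionedIn-translate χ m
  mentionedIn-translate (φ ∧ χ)   (inj₁ m) = mentionedIn-translate φ m
  mentionedIn-translate (φ ∧ χ)   (inj₂ m) = mentionedIn-translate χ m
  mentionedIn-translate (⟨ a ⟩ φ) m        = mentionedIn-translate φ m
  mentionedIn-translate ([ a ] φ) m        = mentionedIn-translate φ m
  mentionedIn-translate (μ Y ∙ φ) m        =
    mentionedIn-repack Y φ (mentionedIn-assign controls (bit Y) m)
  mentionedIn-translate (ν Y ∙ φ) m        =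
    mentionedIn-repack Y φ (mentionedIn-assign controls (bit Y) m)
  mentionedIn-repack Z φ (inj₁ eq)               = inj₂ eq
  mentionedIn-repack Z φ (inj₂ (inj₁ (inj₂ m)))  = Sum.swap (mentionedIn-translate φ m)
  mentionedIn-repack Z φ (inj₂ (inj₂ (inj₂ eq))) = inj₁ eq

  -- Under a binder the body is translated with the roles exchanged, so its only possible free
  -- variable is `V`, which the new fixpoint binds; `U` enters through the else branch of `repack`.
  freeIn-translate : ∀ {X U V} φ → X freeIn translate U V φ → X ≡ plain U
  freeIn-repack : ∀ {X U V} Z φ → X ≢ plain V × X freeIn repack Z U (translate V U φ) →
                  X ≡ plain U
  freeIn-translate (pvar Y)  f        = freeIn-assign controls (bit Y) f
  freeIn-translate (φ ∨ χ)   (inj₁ f) = freeIn-translate φ f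
  freeIn-translate (φ ∨ χ)   (inj₂ f) = freeIn-translate χ f
  freeIn-translate (φ ∧ χ)   (inj₁ f) = freeIn-translate φ f
  freeIn-translate (φ ∧ χ)   (inj₂ f) = freeIn-translate χ f
  freeIn-translate (⟨ a ⟩ φ) f        = freeIn-translate φ f
  freeIn-translate ([ a ] φ) f        = freeIn-translate φ f
  freeIn-translate (μ Y ∙ φ) f        =
    freeIn-repack Y φ (freeIn-assign controls (bit Y) f)
  freeIn-translate (ν Y ∙ φ) f        =
    freeIn-repack Y φ (freeIn-assign controls (bit Y) f)
  freeIn-repack Z φ (X≢V , inj₁ (inj₂ f))  = contradiction (freeIn-translate φ f) X≢V
  freeIn-repack Z φ (X≢V , inj₂ (inj₂ eq)) = eq

  -- A variable and its complement have separate codes, so both become plain occurrences. This gives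
  -- the side condition on the new binders.
  compl∉translate : ∀ {W U V} φ → ¬ compl W mentionedIn translate U V φ
  compl∉translate φ m with mentionedIn-translate φ m
  ... | inj₁ ()
  ... | inj₂ ()

  wellFormed-translate : ∀ U V {φ} → WellFormed φ → WellFormed (translate U V φ)
  wellFormed-repack : ∀ Z {U V φ} → WellFormed φ → WellFormed (repack Z U (translate V U φ))
  compl∉repack : ∀ {W U V} Z φ → ¬ compl W mentionedIn repack Z U (translate V U φ)
  wellFormed-translate U V (lit p)       = lit p
  wellFormed-translate U V (pvar X)      = wellFormed-assign controls (bit X) (pvar (plain U))
  wellFormed-translate U V (w ∨ w′)      = wellFormed-translate U V w ∨ wellFormed-translate U V w′
  wellFormed-translate U V (w ∧ w′)      = wellFormed-translate U V w ∧ wellFormed-translate U V w′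
  wellFormed-translate U V (⟨ a ⟩ w)     = ⟨ a ⟩ wellFormed-translate U V w
  wellFormed-translate U V ([ a ] w)     = [ a ] wellFormed-translate U V w
  wellFormed-translate U V (μ {X} {φ} _ w) =
    wellFormed-assign controls (bit X) (μ (compl∉repack X φ) (wellFormed-repack X w))
  wellFormed-translate U V (ν {X} {φ} _ w) =
    wellFormed-assign controls (bit X) (ν (compl∉repack X φ) (wellFormed-repack X w))
  wellFormed-repack Z w =
    (lit _ ∧ wellFormed-translate _ _ w) ∨ (lit _ ∧ pvar _)
  compl∉repack Z φ (inj₁ (inj₂ m))  = compl∉translate φ m
  compl∉repack Z φ (inj₂ (inj₂ ()))

module Soundness (em : ExcludedMiddle 0ℓ) (ext : Extensionality 0ℓ 0ℓ) where
  open Semantics em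

  -- Truth values, extensional sets and pointwise overwriting.

  does⁻ : {P : Set} → T (does (em {P})) → P
  does⁻ {P} t with em {P}
  ... | yes p = p

  does⁺ : {P : Set} → P → T (does (em {P}))
  does⁺ {P} p with em {P}
  ... | yes _ = tt
  ... | no ¬p = ¬p p

  ⊆ₛ-antisym : {A : Set} {D E : 𝒫 A} → D ⊆ₛ E → E ⊆ₛ D → D ≡ E
  ⊆ₛ-antisym D⊆E E⊆D = ext λ a → T-injective (D⊆E a) (E⊆D a)
    where
    T-injective : ∀ {b c} → (T b → T c) → (T c → T b) → b ≡ c
    T-injective {false} {false} f g = refl
    T-injective {false} {true}  f g = ⊥-elim (g tt)
    T-injective {true}  {false} f g = ⊥-elim (f tt)
    T-injective {true}  {true}  f g = refl

  update-≡ : {A B : Set} (f : A → B) (x : A) (b : B) → (f [ x ↦ b ]) x ≡ b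
  update-≡ f x b with em {x ≡ x}
  ... | yes _   = refl
  ... | no x≢x = contradiction refl x≢x

  update-≢ : {A B : Set} (f : A → B) {x y : A} (b : B) → y ≢ x → (f [ x ↦ b ]) y ≡ f y
  update-≢ f {x} {y} b y≢x with em {y ≡ x}
  ... | yes y≡x = contradiction y≡x y≢x
  ... | no _    = refl

  overwrite : {A B : Set} → List A → (A → B) → (A → B) → (A → B)
  overwrite []       g f = f
  overwrite (y ∷ ys) g f = overwrite ys g (f [ y ↦ g y ])

  overwrite-∉ : {A B : Set} (ys : List A) {g f : A → B} {x : A} →
                x ∉ ys → overwrite ys g f x ≡ f x
  overwrite-∉ []       x∉ = refl
  overwrite-∉ (y ∷ ys) {f = f} x∉ =
    trans (overwrite-∉ ys (x∉ ∘ there)) (update-≢ f _ (x∉ ∘ here))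

  -- The list may have repetitions, as `pvars` does, so the case split is on whether `x` occurs
  -- again in the tail; every write at `x` stores the same value `g x`.
  overwrite-∈ : {A B : Set} (ys : List A) {g f : A → B} {x : A} →
                x ∈ ys → overwrite ys g f x ≡ g x
  overwrite-∈ (y ∷ ys) {f = f} {x} x∈ with em {x ∈ ys} | x∈
  ... | yes x∈ys | _         = overwrite-∈ ys x∈ys
  ... | no  x∉ys | here refl = trans (overwrite-∉ ys x∉ys) (update-≡ f x _)
  ... | no  x∉ys | there x∈′ = contradiction x∈′ x∉ys

  AgreeOff : {A B : Set} → List A → Rel (A → B) 0ℓ
  AgreeOff ys f g = ∀ x → x ∉ ys → f x ≡ g x

  agreeOff-sym : {A B : Set} {ys : List A} {f g : A → B} → AgreeOff ys f g → AgreeOff ys g f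
  agreeOff-sym f~g x x∉ = sym (f~g x x∉)

  agreeOff-overwrite : {A B : Set} (ys : List A) (g f : A → B) → AgreeOff ys f (overwrite ys g f)
  agreeOff-overwrite ys g f x x∉ = sym (overwrite-∉ ys x∉)

  overwrite-cong : {A B : Set} (ys : List A) (g : A → B) {f f′ : A → B} →
                   AgreeOff ys f f′ → overwrite ys g f ≡ overwrite ys g f′
  overwrite-cong ys g {f} {f′} f~f′ = ext λ x → case em {x ∈ ys} of λ where
    (yes x∈) → trans (overwrite-∈ ys x∈) (sym (overwrite-∈ ys x∈))
    (no  x∉) → trans (overwrite-∉ ys x∉) (trans (f~f′ x x∉) (sym (overwrite-∉ ys x∉)))

  overwrite-agreeOff : {A B : Set} (ys : List A) {f g : A → B} →
                       AgreeOff ys f g → overwrite ys g f ≡ g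
  overwrite-agreeOff ys f~g = ext λ x → case em {x ∈ ys} of λ where
    (yes x∈) → overwrite-∈ ys x∈
    (no  x∉) → trans (overwrite-∉ ys x∉) (f~g x x∉)

  -- Fixpoints compared along a binary relation.

  module Fixpoints {S : Set} where

    lfp gfp : (𝒫 S → 𝒫 S) → 𝒫 S
    lfp F = ⟪ (λ ω → ∀ D → F D ⊆ₛ D → ω ∈ₛ D) ⟫
    gfp F = ⟪ (λ ω → ∃[ D ] D ⊆ₛ F D × ω ∈ₛ D) ⟫

    lfp-least : ∀ {F D} → F D ⊆ₛ D → lfp F ⊆ₛ D
    lfp-least FD⊆D ω l = does⁻ l _ FD⊆D

    gfp-greatest : ∀ {F D} → D ⊆ₛ F D → D ⊆ₛ gfp F
    gfp-greatest D⊆FD ω d = does⁺ (_ , D⊆FD , d)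

    module _ (_~_ : Rel S 0ℓ) where

      infix 4 _⊑_
      _⊑_ : Rel (𝒫 S) 0ℓ
      D ⊑ E = ∀ {ω ω′} → ω ~ ω′ → ω ∈ₛ D → ω′ ∈ₛ E

      -- For a prefixed point `E` of `G`, the states whose `~`-successors all lie in `E` form the
      -- largest `D` with `D ⊑ E`. It is prefixed for `F`, hence contains `lfp F`.
      lfp-⊑ : ∀ {F G} → (∀ {D E} → D ⊑ E → F D ⊑ G E) → lfp F ⊑ lfp G
      lfp-⊑ {F} {G} F⊑G ω~ω′ l = does⁺ λ E GE⊆E →
        let D : 𝒫 S
            D = ⟪ (λ υ → ∀ υ′ → υ ~ υ′ → υ′ ∈ₛ E) ⟫
            D⊑E : D ⊑ E
            D⊑E υ~υ′ d = does⁻ d _ υ~υ′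
            FD⊆D : F D ⊆ₛ D
            FD⊆D υ f = does⁺ λ υ′ υ~υ′ → GE⊆E υ′ (F⊑G D⊑E υ~υ′ f)
        in D⊑E ω~ω′ (lfp-least {F} {D} FD⊆D _ l)

      -- Dually, the `~`-image of a postfixed point of `F` is a postfixed point of `G`.
      gfp-⊑ : ∀ {F G} → (∀ {D E} → D ⊑ E → F D ⊑ G E) → gfp F ⊑ gfp G
      gfp-⊑ {F} {G} F⊑G {ω} {ω′} ω~ω′ g with does⁻ g
      ... | D , D⊆FD , d = gfp-greatest {G} {E} E⊆GE ω′ (D⊑E ω~ω′ d)
        where
        E : 𝒫 S
        E = ⟪ (λ υ′ → ∃[ υ ] υ ~ υ′ × υ ∈ₛ D) ⟫
        D⊑E : D ⊑ E
        D⊑E υ~υ′ d = does⁺ (_ , υ~υ′ , d)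
        E⊆GE : E ⊆ₛ G E
        E⊆GE υ′ e with does⁻ e
        ... | υ , υ~υ′ , d = F⊑G D⊑E υ~υ′ (D⊆FD υ d)

      -- One half of Knaster-Tarski along `~`: for each prefixed `E`, `lfp-⊑` and leastness give
      -- `lfp F ⊑ E`, so `F (lfp F) ⊑ F E`, and `F E ⊆ₛ E`.
      lfp-prefixed : ∀ {F} → (∀ {D E} → D ⊑ E → F D ⊑ F E) → F (lfp F) ⊑ lfp F
      lfp-prefixed F⊑F ω~ω′ f = does⁺ λ E FE⊆E →
        FE⊆E _ (F⊑F (λ υ~υ′ → lfp-least FE⊆E _ ∘ lfp-⊑ F⊑F υ~υ′) ω~ω′ f)

      gfp-postfixed : ∀ {F} → (∀ {D E} → D ⊑ E → F D ⊑ F E) → gfp F ⊑ F (gfp F)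
      gfp-postfixed F⊑F ω~ω′ g with does⁻ g
      ... | D , D⊆FD , d =
        F⊑F (λ υ~υ′ → gfp-⊑ F⊑F υ~υ′ ∘ gfp-greatest D⊆FD _) ω~ω′ (D⊆FD _ d)

    -- F is the operator of a fixpoint in the original formula, H that of the
    -- translated body acting on packed sets, and G that of the translated
    -- fixpoint, which differs from H by restoring the old pack U off the codes.
    module Pack
      (_~_ : Rel S 0ℓ) (~-refl : ∀ {ω} → ω ~ ω) (~-sym : ∀ {ω ω′} → ω ~ ω′ → ω′ ~ ω)
      (code : S → S) (~-code : ∀ ω → ω ~ code ω)
      (code-cong : ∀ {ω ω′} → ω ~ ω′ → code ω ≡ code ω′)
      (C : Pred S 0ℓ) (C-code : ∀ ω → C (code ω))
      (U : 𝒫 S) (F G H : 𝒫 S → 𝒫 S)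
      (F-⊑ : ∀ {D E} → _⊑_ _~_ D E → _⊑_ _~_ (F D) (F E))
      (H-mono : ∀ {D E} → D ⊆ₛ E → H D ⊆ₛ H E)
      (G-on  : ∀ {E υ} → C υ → G E υ ≡ H E υ)
      (G-off : ∀ {E υ} → ¬ C υ → G E υ ≡ U υ)
      (F≡H : ∀ {D E} → (∀ ω → E (code ω) ≡ D ω) → (∀ {υ} → ¬ C υ → E υ ≡ U υ) → F D ≡ H E)
      where

      pack : 𝒫 S → 𝒫 S
      pack D υ = if ⟪ C ⟫ υ then D υ else U υ

      pack-on : ∀ D {υ} → C υ → pack D υ ≡ D υ
      pack-on D {υ} c with em {C υ}
      ... | yes _ = refl
      ... | no ¬c = contradiction c ¬c

      pack-off : ∀ D {υ} → ¬ C υ → pack D υ ≡ U υ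
      pack-off D {υ} ¬c with em {C υ}
      ... | yes c = contradiction c ¬c
      ... | no _  = refl

      -- Invariance under `~` means that `D` is recovered from its values at codes.
      F≡H-pack : ∀ D → _⊑_ _~_ D D → F D ≡ H (pack D)
      F≡H-pack D D⊑D = F≡H
        (λ ω → trans (pack-on D (C-code ω)) (cong (λ D → D ω) D∘code≡D)) (pack-off D)
        where
        D∘code≡D : D ∘ code ≡ D
        D∘code≡D = ⊆ₛ-antisym (λ υ → D⊑D (~-sym (~-code υ))) (λ υ → D⊑D (~-code υ))

      -- An arbitrary `E` may differ from `U` off the codes, so it has to be replaced by `pack E`,
      -- which decodes to the same set.
      F≡H-unpack : ∀ E → F (E ∘ code) ≡ H (pack E)
      F≡H-unpack E = F≡H (λ ω → pack-on E (C-code ω)) (pack-off E)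

      unpack-⊑ : ∀ E → _⊑_ _~_ (E ∘ code) (E ∘ code)
      unpack-⊑ E ω~ω′ = subst (_∈ₛ E) (code-cong ω~ω′)

      -- Prefixed points are transported both ways: `E` for `G` yields `E ∘ code` for `F`, and
      -- `lfp F` yields `pack (lfp F)` for `G`.
      lfp-pack : lfp F ≡ lfp G ∘ code
      lfp-pack = ⊆ₛ-antisym F⊆G G⊆F
        where
        F⊆G : lfp F ⊆ₛ lfp G ∘ code
        F⊆G ω l = does⁺ λ E GE⊆E →
          -- Off the codes `G E` is `U`, so prefixedness of `E` forces `U` below `E` there.
          let pack⊆E : pack E ⊆ₛ E
              pack⊆E υ p = case em {C υ} of λ where
                (yes c) → subst T (pack-on E c) p
                (no ¬c) → GE⊆E υ (subst T (trans (pack-off E ¬c) (sym (G-off ¬c))) p)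
          in lfp-least {D = E ∘ code} (λ υ f →
               -- Invariance of `F (E ∘ code)` moves membership from `υ` to `code υ`, where
               -- `F (E ∘ code) ≡ H (pack E)`, `H (pack E) ⊆ₛ H E`, and `H E` agrees with `G E`.
               GE⊆E (code υ) (subst T (sym (G-on (C-code υ)))
                 (H-mono pack⊆E (code υ)
                   (subst (code υ ∈ₛ_) (F≡H-unpack E) (F-⊑ (unpack-⊑ E) (~-code υ) f))))) ω l

        G⊆F : lfp G ∘ code ⊆ₛ lfp F
        G⊆F ω l = lfp-⊑ _~_ F-⊑ (~-sym (~-code ω))
          (subst T (pack-on (lfp F) (C-code ω)) (lfp-least GP⊆P (code ω) l))
          where
          GP⊆P : G (pack (lfp F)) ⊆ₛ pack (lfp F)
          GP⊆P υ g = case em {C υ} of λ where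
            (yes c) → subst T (sym (pack-on (lfp F) c)) (lfp-prefixed _~_ F-⊑ ~-refl
                        (subst (υ ∈ₛ_) (sym (F≡H-pack (lfp F) (lfp-⊑ _~_ F-⊑))) (subst T (G-on c) g)))
            (no ¬c) → subst T (trans (G-off ¬c) (sym (pack-off (lfp F) ¬c))) g

      -- The same transport for postfixed points; here `E ⊆ₛ G E` gives `E ⊆ₛ pack E`.
      gfp-pack : gfp F ≡ gfp G ∘ code
      gfp-pack = ⊆ₛ-antisym F⊆G G⊆F
        where
        F⊆G : gfp F ⊆ₛ gfp G ∘ code
        F⊆G ω g = gfp-greatest P⊆GP (code ω)
          (subst T (sym (pack-on (gfp F) (C-code ω))) (gfp-⊑ _~_ F-⊑ (~-code ω) g))
          where
          P⊆GP : pack (gfp F) ⊆ₛ G (pack (gfp F))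
          P⊆GP υ p = case em {C υ} of λ where
            (yes c) → subst T (sym (G-on c))
                        (subst (υ ∈ₛ_) (F≡H-pack (gfp F) (gfp-⊑ _~_ F-⊑))
                          (gfp-postfixed _~_ F-⊑ ~-refl (subst T (pack-on (gfp F) c) p)))
            (no ¬c) → subst T (trans (pack-off (gfp F) ¬c) (sym (G-off ¬c))) p

        G⊆F : gfp G ∘ code ⊆ₛ gfp F
        G⊆F ω g with does⁻ g
        ... | E , E⊆GE , e = gfp-greatest {D = E ∘ code} (λ υ d →
            F-⊑ (unpack-⊑ E) (~-sym (~-code υ))
              (subst (code υ ∈ₛ_) (sym (F≡H-unpack E))
                (H-mono E⊆pack (code υ) (subst T (G-on (C-code υ)) (E⊆GE (code υ) d))))) ω e
          where
          E⊆pack : E ⊆ₛ pack E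
          E⊆pack υ d = case em {C υ} of λ where
            (yes c) → subst T (sym (pack-on E c)) d
            (no ¬c) → subst T (trans (G-off ¬c) (sym (pack-off E ¬c))) (E⊆GE υ d)

  open Fixpoints

  -- Monotonicity and bisimulation invariance of the semantics.

  module _ {L : Signature} {𝒳 : Set} (𝔄 : Structure L 𝒳) where
    open Structure 𝔄

    -- An update at `X` also changes the value at `complement X`; that case is excluded because a
    -- well-formed binder does not mention the complement in its body.
    extend-update : {𝒱 : Set} (Ω : Valuation {𝒱 = 𝒱} 𝔄) (X : PVar 𝒱) (D : 𝒫 State) {Z : PVar 𝒱} →
      Z ≢ complement X →
      (Z ≡ X × extend 𝔄 (updateᵛ 𝔄 Ω X D) Z ≡ D) ⊎
      (Z ≢ X × extend 𝔄 (updateᵛ 𝔄 Ω X D) Z ≡ extend 𝔄 Ω Z)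
    extend-update Ω (plain X) D {plain Z} _ with em {Z ≡ X}
    ... | yes refl = inj₁ (refl , refl)
    ... | no Z≢X   = inj₂ ((λ { refl → Z≢X refl }) , refl)
    extend-update Ω (plain X) D {compl Z} Z≢X̄ with em {Z ≡ X}
    ... | yes refl = contradiction refl Z≢X̄
    ... | no Z≢X   = inj₂ ((λ ()) , refl)
    extend-update Ω (compl X) D {plain Z} Z≢X̄ with em {Z ≡ X}
    ... | yes refl = contradiction refl Z≢X̄
    ... | no Z≢X   = inj₂ ((λ ()) , refl)
    extend-update Ω (compl X) D {compl Z} _ with em {Z ≡ X}
    -- Updating at a complement stores `∁ D`, and reading it back complements again.
    ... | yes refl = inj₁ (refl , ext λ ω → not-involutive (D ω))
    ... | no Z≢X   = inj₂ ((λ { refl → Z≢X refl }) , refl)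

    Bisimulation : Rel State 0ℓ → Signature.Act L → Set
    Bisimulation _~_ a =
      (∀ {ω ω′ υ} → ω ~ ω′ → actᴵ a ω υ → ∃[ υ′ ] υ ~ υ′ × actᴵ a ω′ υ′) ×
      (∀ {ω ω′ υ′} → ω ~ ω′ → actᴵ a ω′ υ′ → ∃[ υ ] υ ~ υ′ × actᴵ a ω υ)

    module _ {𝒱 : Set} (_~_ : Rel State 0ℓ) where

      Respects : Formula L 𝒳 𝒱 → Set
      Respects (lit p)   = ∀ {ω ω′} → ω ~ ω′ → ω ⊨ p → ω′ ⊨ p
      Respects (pvar X)  = ⊤
      Respects (φ ∨ χ)   = Respects φ × Respects χ
      Respects (φ ∧ χ)   = Respects φ × Respects χ
      Respects (⟨ a ⟩ φ) = Bisimulation _~_ a × Respects φ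
      Respects ([ a ] φ) = Bisimulation _~_ a × Respects φ
      Respects (μ X ∙ φ) = Respects φ
      Respects (ν X ∙ φ) = Respects φ

      private
        _⊑′_ : Rel (𝒫 State) 0ℓ
        _⊑′_ = _⊑_ _~_

      -- Monotonicity if _~_ is _≡_, and invariance under _~_ if Ω′ is Ω.
      ⟦⟧-⊑ : ∀ {φ : Formula L 𝒳 𝒱} → WellFormed φ → Respects φ → ∀ {Ω Ω′ : Valuation {𝒱 = 𝒱} 𝔄} →
             (∀ Z → Z freeIn φ → extend 𝔄 Ω Z ⊑′ extend 𝔄 Ω′ Z) →
             ⟦_⟧μ 𝔄 φ Ω ⊑′ ⟦_⟧μ 𝔄 φ Ω′
      update-⊑ : ∀ X (φ : Formula L 𝒳 𝒱) → ¬ complement X mentionedIn φ → {Ω Ω′ : Valuation {𝒱 = 𝒱} 𝔄} →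
                 (∀ Z → Z ≢ X × Z freeIn φ → extend 𝔄 Ω Z ⊑′ extend 𝔄 Ω′ Z) →
                 ∀ {D E} → D ⊑′ E → ∀ Z → Z freeIn φ →
                 extend 𝔄 (updateᵛ 𝔄 Ω X D) Z ⊑′ extend 𝔄 (updateᵛ 𝔄 Ω′ X E) Z

      ⟦⟧-⊑ (lit p) r h ω~ω′ = does⁺ ∘ r ω~ω′ ∘ does⁻
      ⟦⟧-⊑ (pvar X) r h = h X refl
      ⟦⟧-⊑ (w ∨ w′) (r , r′) h ω~ω′ =
        Equivalence.from T-∨ ∘
        Sum.map (⟦⟧-⊑ w r (λ Z → h Z ∘ inj₁) ω~ω′) (⟦⟧-⊑ w′ r′ (λ Z → h Z ∘ inj₂) ω~ω′) ∘
        Equivalence.to T-∨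
      ⟦⟧-⊑ (w ∧ w′) (r , r′) h ω~ω′ t with Equivalence.to T-∧ t
      ... | t₁ , t₂ = Equivalence.from T-∧
        (⟦⟧-⊑ w r (λ Z → h Z ∘ inj₁) ω~ω′ t₁ , ⟦⟧-⊑ w′ r′ (λ Z → h Z ∘ inj₂) ω~ω′ t₂)
      ⟦⟧-⊑ (⟨ a ⟩ w) ((forth , back) , r) h ω~ω′ t with does⁻ t
      ... | υ , ωaυ , t′ with forth ω~ω′ ωaυ
      ... | υ′ , υ~υ′ , ω′aυ′ = does⁺ (υ′ , ω′aυ′ , ⟦⟧-⊑ w r h υ~υ′ t′)
      ⟦⟧-⊑ ([ a ] w) ((forth , back) , r) h ω~ω′ t = does⁺ λ υ′ ω′aυ′ →
        let υ , υ~υ′ , ωaυ = back ω~ω′ ω′aυ′ in ⟦⟧-⊑ w r h υ~υ′ (does⁻ t υ ωaυ)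
      ⟦⟧-⊑ (μ {X} {φ} X̄∉ w) r h =
        lfp-⊑ _~_ λ D⊑E → ⟦⟧-⊑ w r (update-⊑ X φ X̄∉ h D⊑E)
      ⟦⟧-⊑ (ν {X} {φ} X̄∉ w) r h =
        gfp-⊑ _~_ λ D⊑E → ⟦⟧-⊑ w r (update-⊑ X φ X̄∉ h D⊑E)

      update-⊑ X φ X̄∉ {Ω} {Ω′} h {D} {E} D⊑E Z f
        with extend-update Ω X D {Z} Z≢X̄ | extend-update Ω′ X E {Z} Z≢X̄
        where
        Z≢X̄ : Z ≢ complement X
        Z≢X̄ refl = X̄∉ (freeIn⇒mentionedIn φ f)
      ... | inj₁ (_ , p)   | inj₁ (_ , q)   rewrite p | q = D⊑E
      ... | inj₂ (Z≢X , p) | inj₂ (_ , q)   rewrite p | q = h Z (Z≢X , f)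
      ... | inj₁ (Z≡X , _) | inj₂ (Z≢X , _) = contradiction Z≡X Z≢X
      ... | inj₂ (Z≢X , _) | inj₁ (Z≡X , _) = contradiction Z≡X Z≢X

    respects-≡ : {𝒱 : Set} (φ : Formula L 𝒳 𝒱) → Respects _≡_ φ
    respects-≡ (lit p)   refl = id
    respects-≡ (pvar X)  = tt
    respects-≡ (φ ∨ χ)   = respects-≡ φ , respects-≡ χ
    respects-≡ (φ ∧ χ)   = respects-≡ φ , respects-≡ χ
    respects-≡ (⟨ a ⟩ φ) =
      ((λ { refl s → _ , refl , s }) , (λ { refl s → _ , refl , s })) , respects-≡ φ
    respects-≡ ([ a ] φ) =
      ((λ { refl s → _ , refl , s }) , (λ { refl s → _ , refl , s })) , respects-≡ φ
    respects-≡ (μ X ∙ φ) = respects-≡ φ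
    respects-≡ (ν X ∙ φ) = respects-≡ φ

    ⟦⟧-mono : {𝒱 : Set} {φ : Formula L 𝒳 𝒱} → WellFormed φ → ∀ {Ω Ω′ : Valuation {𝒱 = 𝒱} 𝔄} →
              (∀ Z → Z freeIn φ → extend 𝔄 Ω Z ⊆ₛ extend 𝔄 Ω′ Z) →
              ⟦_⟧μ 𝔄 φ Ω ⊆ₛ ⟦_⟧μ 𝔄 φ Ω′
    ⟦⟧-mono {φ = φ} w h ω = ⟦⟧-⊑ _≡_ w (respects-≡ φ) (λ { Z f refl → h Z f _ }) refl

    value-cong : ∀ {ω ω′ : State} θ → (∀ {y} → y inTerm θ → ω y ≡ ω′ y) →
                 value ω θ ≡ value ω′ θ
    values-cong : ∀ {ω ω′ : State} {n} (θs : Vec (Term L 𝒳) n) →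
                  (∀ {y} → Any (y inTerm_) θs → ω y ≡ ω′ y) →
                  values ω θs ≡ values ω′ θs
    value-cong (var x)    h = h var
    value-cong (app f θs) h = cong (funcᴵ f) (values-cong θs (h ∘ app))
    values-cong []       h = refl
    values-cong (θ ∷ θs) h = cong₂ _∷_ (value-cong θ (h ∘ here)) (values-cong θs (h ∘ there))

    -- An equality of propositions, so that substitution serves positive and negative literals
    -- alike.
    atom-cong : ∀ {ω ω′ : State} α → (∀ {y} → y inAtom α → ω y ≡ ω′ y) →
                (ω ⊨ᵃ α) ≡ (ω′ ⊨ᵃ α)
    atom-cong (rel R θs) h = cong (relᴵ R) (values-cong θs h)
    atom-cong (θ ≈ η)    h =
      cong₂ _≡_ (value-cong θ (h ∘ inj₁)) (value-cong η (h ∘ inj₂))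

    literal-cong : ∀ {ω ω′ : State} p → (∀ {y} → y inLiteral p → ω y ≡ ω′ y) → ω ⊨ p → ω′ ⊨ p
    literal-cong (pos α) h = subst id (atom-cong α h)
    literal-cong (neg α) h = subst ¬_ (atom-cong α h)

    module _ {ys : List 𝒳} where

      independent-overwrite :
        ∀ {a} (zs : List 𝒳) → (∀ {y} → y ∈ zs → Independent 𝔄 y a) →
        ∀ g {ω υ} → actᴵ a ω υ → actᴵ a (overwrite zs g ω) (overwrite zs g υ)
      independent-overwrite []       ind g s = s
      independent-overwrite (z ∷ zs) ind g s =
        independent-overwrite zs (ind ∘ there) g (ind (here refl) s (g z))

      -- To match a transition from `ω` to `υ` at `ω′`, both ends are overwritten on `ys` with the
      -- values of `ω′`. This turns `ω` into `ω′` itself, since the two agree off `ys`. The converse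
      -- direction follows by symmetry.
      independent⇒bisimulation : ∀ {a} → (∀ {y} → y ∈ ys → Independent 𝔄 y a) →
                                 Bisimulation (AgreeOff ys) a
      independent⇒bisimulation {a} ind = forth , back
        where
        forth : ∀ {ω ω′ υ} → AgreeOff ys ω ω′ → actᴵ a ω υ →
                ∃[ υ′ ] AgreeOff ys υ υ′ × actᴵ a ω′ υ′
        forth {ω′ = ω′} {υ} ω~ω′ s =
          overwrite ys ω′ υ , agreeOff-overwrite ys ω′ υ ,
          subst (λ z → actᴵ a z _) (overwrite-agreeOff ys ω~ω′) (independent-overwrite ys ind ω′ s)
        back : ∀ {ω ω′ υ′} → AgreeOff ys ω ω′ → actᴵ a ω′ υ′ →
               ∃[ υ ] AgreeOff ys υ υ′ × actᴵ a ω υ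
        back ω~ω′ s with forth (agreeOff-sym ω~ω′) s
        ... | υ , υ′~υ , s′ = υ , agreeOff-sym υ′~υ , s′

      respects-agreeOff :
        {𝒱 : Set} (da : DeterministicAssignments L 𝒳) (φ : Formula L 𝒳 𝒱) →
        (∀ {y} → y ∈ ys → ¬ _inFormula_ da y φ) →
        (∀ {y a} → y ∈ ys → a actionOf φ → Independent 𝔄 y a) →
        Respects (AgreeOff ys) φ
      respects-agreeOff da (lit p) fr ind ω~ω′ =
        literal-cong p λ y∈p → ω~ω′ _ λ y∈ys → fr y∈ys y∈p
      respects-agreeOff da (pvar X)  fr ind = tt
      respects-agreeOff da (φ ∨ χ)   fr ind =
        respects-agreeOff da φ (λ i → fr i ∘ inj₁) (λ i → ind i ∘ inj₁) ,
        respects-agreeOff da χ (λ i → fr i ∘ inj₂) (λ i → ind i ∘ inj₂)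
      respects-agreeOff da (φ ∧ χ)   fr ind =
        respects-agreeOff da φ (λ i → fr i ∘ inj₁) (λ i → ind i ∘ inj₁) ,
        respects-agreeOff da χ (λ i → fr i ∘ inj₂) (λ i → ind i ∘ inj₂)
      respects-agreeOff da (⟨ a ⟩ φ) fr ind =
        independent⇒bisimulation (λ i → ind i (inj₁ refl)) ,
        respects-agreeOff da φ (λ i → fr i ∘ inj₂) (λ i → ind i ∘ inj₂)
      respects-agreeOff da ([ a ] φ) fr ind =
        independent⇒bisimulation (λ i → ind i (inj₁ refl)) ,
        respects-agreeOff da φ (λ i → fr i ∘ inj₂) (λ i → ind i ∘ inj₂)
      respects-agreeOff da (μ X ∙ φ) fr ind = respects-agreeOff da φ fr ind
      respects-agreeOff da (ν X ∙ φ) fr ind = respects-agreeOff da φ fr ind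

    -- The second clause compares the codes of `X` and `Y` at the pivot of `Y`, which is where
    -- `test Y` looks.
    CodingAvailable : {𝒱 : Set} {da : DeterministicAssignments L 𝒳} {ψ : Formula L 𝒳 𝒱} →
                      Coding da ψ → Set
    CodingAvailable {ψ = ψ} κ =
      (∀ {y a} → y ∈ controls → a actionOf ψ → Independent 𝔄 y a) ×
      (∀ {X Y} → X mentionedIn ψ → Y mentionedIn ψ → X ≢ Y →
        funcᴵ (bit X (pivot Y)) [] ≢ funcᴵ (bit Y (pivot Y)) [])
      where open Coding κ

    -- Correctness of the translation.

    module _ {𝒱 : Set} (da : DeterministicAssignments L 𝒳) (as : IsAssignmentStructure 𝔄 da)
             {ψ : Formula L 𝒳 𝒱} (κ : Coding da ψ) (av : CodingAvailable κ) where
      open Coding κ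
      open Translation da κ
      open DeterministicAssignments da

      -- Each assignment has exactly one successor, so its diamond is composition with the state
      -- update.
      ⟦assign⟧ : ∀ ys f χ (Ω : Valuation 𝔄) →
                 ⟦_⟧μ 𝔄 (assign ys f χ) Ω ≡
                 ⟦_⟧μ 𝔄 χ Ω ∘ overwrite ys (λ y → funcᴵ (f y) [])
      ⟦assign⟧ []       f χ Ω = refl
      ⟦assign⟧ (y ∷ ys) f χ Ω =
        trans (⊆ₛ-antisym to from) (cong (_∘ step) (⟦assign⟧ ys f χ Ω))
        where
        step : State → State
        step ω = ω [ y ↦ funcᴵ (f y) [] ]
        module Assigns ω ω′ = Equivalence (proj₂ as y (app (f y) []) ω ω′)
        to : ⟦_⟧μ 𝔄 (assign (y ∷ ys) f χ) Ω ⊆ₛ ⟦_⟧μ 𝔄 (assign ys f χ) Ω ∘ step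
        to ω t with does⁻ t
        ... | ω′ , s , t′ = subst (_∈ₛ ⟦_⟧μ 𝔄 (assign ys f χ) Ω) (Assigns.to ω ω′ s) t′
        from : ⟦_⟧μ 𝔄 (assign ys f χ) Ω ∘ step ⊆ₛ ⟦_⟧μ 𝔄 (assign (y ∷ ys) f χ) Ω
        from ω t = does⁺ (step ω , Assigns.from ω (step ω) refl , t)

      code : PVar 𝒱 → State → State
      code X = overwrite controls (λ y → funcᴵ (bit X y) [])

      -- Only the pivot is inspected, so this may hold outside the range of `code X`. What matters
      -- is that codes of `X` satisfy it and codes of the other variables mentioned in `ψ` do not.
      IsCode : PVar 𝒱 → Pred State 0ℓ
      IsCode X ω = ω ⊨ᵃ test X

      isCode-code : ∀ {X} → X mentionedIn ψ → ∀ ω → IsCode X (code X ω)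
      isCode-code m ω = overwrite-∈ controls (pivot∈ m)

      ¬isCode-code : ∀ {X Y} → X mentionedIn ψ → Y mentionedIn ψ → X ≢ Y →
                     ∀ ω → ¬ IsCode Y (code X ω)
      ¬isCode-code mX mY X≢Y ω eq =
        proj₂ av mX mY X≢Y (trans (sym (overwrite-∈ controls (pivot∈ mY))) eq)

      Packs : 𝒫 State → Valuation 𝔄 → Formula L 𝒳 𝒱 → Set
      Packs E Ω φ = ∀ Z → Z freeIn φ → ∀ ω → extend 𝔄 Ω Z ω ≡ E (code Z ω)

      private
        _~_ : Rel State 0ℓ
        _~_ = AgreeOff controls

      -- Induction on `φ` for all `U`, `V` and both valuations, since a binder exchanges the former
      -- and updates the latter.
      ⟦translate⟧ : ∀ {φ} → WellFormed φ → Respects (AgreeOff controls) φ →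
                    (∀ Z → Z mentionedIn φ → Z mentionedIn ψ) →
                    ∀ {U V} → U ≢ V → ∀ {Ω Ω′ : Valuation 𝔄} → Packs (Ω′ U) Ω φ →
                    ⟦_⟧μ 𝔄 φ Ω ≡ ⟦_⟧μ 𝔄 (translate U V φ) Ω′

      module Binder
        X {φ} (X̄∉φ : ¬ complement X mentionedIn φ) (w : WellFormed φ)
        (r : Respects (AgreeOff controls) φ)
        (m : ∀ Z → Z ≡ X ⊎ Z mentionedIn φ → Z mentionedIn ψ)
        {U V} (U≢V : U ≢ V) {Ω Ω′ : Valuation 𝔄}
        (pk : ∀ Z → Z ≢ X × Z freeIn φ → ∀ ω → extend 𝔄 Ω Z ω ≡ Ω′ U (code Z ω))
        where

        F G H : 𝒫 State → 𝒫 State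
        F D = ⟦_⟧μ 𝔄 φ (updateᵛ 𝔄 Ω X D)
        G E = ⟦_⟧μ 𝔄 (repack X U (translate V U φ)) (updateᵛ 𝔄 Ω′ (plain V) E)
        H E = ⟦_⟧μ 𝔄 (translate V U φ) (updateᵛ 𝔄 Ω′ (plain V) E)

        F-⊑ : ∀ {D E} → _⊑_ _~_ D E → _⊑_ _~_ (F D) (F E)
        F-⊑ D⊑E = ⟦⟧-⊑ _~_ {φ = φ} w r (update-⊑ _~_ X φ X̄∉φ {Ω} {Ω}
          -- Packed values are read at `code Z ω`, which depends only on `ω` off the control
          -- variables.
          (λ Z f {ω} {ω′} ω~ω′ → subst T (trans (pk Z f ω)
            (trans (cong (Ω′ U) (overwrite-cong controls _ ω~ω′)) (sym (pk Z f ω′)))))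
          D⊑E)

        H-mono : ∀ {D E} → D ⊆ₛ E → H D ⊆ₛ H E
        H-mono {D} {E} D⊆E = ⟦⟧-mono (wellFormed-translate V U w) λ Z f ω →
          -- The only possible free variable of the translated body is `V`.
          case freeIn-translate φ f of λ where
            refl t → subst (ω ∈ₛ_) (sym (update-≡ Ω′ V E))
                       (D⊆E ω (subst (ω ∈ₛ_) (update-≡ Ω′ V D) t))

        G-on : ∀ {E υ} → IsCode X υ → G E υ ≡ H E υ
        -- The two guards of `repack` are evaluated by separate appeals to excluded middle, so both
        -- are split on.
        G-on {E} {υ} c with em {IsCode X υ} | em {¬ IsCode X υ}
        ... | yes _ | no _   = ∨-identityʳ _
        ... | yes _ | yes ¬c = contradiction c ¬c
        ... | no ¬c | _      = contradiction c ¬c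

        G-off : ∀ {E υ} → ¬ IsCode X υ → G E υ ≡ Ω′ U υ
        G-off {E} {υ} ¬c with em {IsCode X υ} | em {¬ IsCode X υ}
        ... | yes c | _      = contradiction c ¬c
        ... | no _  | no ¬¬c = contradiction ¬c ¬¬c
        ... | no _  | yes _  = cong (λ D → D υ) (update-≢ Ω′ E U≢V)

        F≡H : ∀ {D E} → (∀ ω → E (code X ω) ≡ D ω) → (∀ {υ} → ¬ IsCode X υ → E υ ≡ Ω′ U υ) →
              F D ≡ H E
        F≡H {D} {E} on off = ⟦translate⟧ w r (λ Z → m Z ∘ inj₂) (≢-sym U≢V) packs
          where
          -- At `X` the new pack yields `D`; for any other `Z` the state `code Z ω` is no code of
          -- `X`, so the new pack agrees there with the old one.
          packs : Packs (updateᵛ 𝔄 Ω′ (plain V) E V) (updateᵛ 𝔄 Ω X D) φ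
          packs Z f ω rewrite update-≡ Ω′ V E with extend-update Ω X D {Z} Z≢X̄
            where
            Z≢X̄ : Z ≢ complement X
            Z≢X̄ refl = X̄∉φ (freeIn⇒mentionedIn φ f)
          ... | inj₁ (refl , eq) = trans (cong (λ D → D ω) eq) (sym (on ω))
          ... | inj₂ (Z≢X , eq)  = trans (cong (λ D → D ω) eq) (trans (pk Z (Z≢X , f) ω)
            (sym (off (¬isCode-code (m Z (inj₂ (freeIn⇒mentionedIn φ f))) (m X (inj₁ refl)) Z≢X ω))))

        open Pack _~_ (λ _ _ → refl) agreeOff-sym
          (code X) (agreeOff-overwrite controls _) (overwrite-cong controls _)
          (IsCode X) (isCode-code (m X (inj₁ refl)))
          (Ω′ U) F G H F-⊑ H-mono G-on G-off F≡H
          public using (lfp-pack; gfp-pack)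

      ⟦translate⟧ (lit p) r m U≢V pk = refl
      ⟦translate⟧ (pvar X) r m {U} U≢V {Ω} {Ω′} pk =
        trans (ext (pk X refl)) (sym (⟦assign⟧ controls (bit X) (pvar (plain U)) Ω′))
      ⟦translate⟧ (w ∨ w′) (r , r′) m U≢V pk =
        cong₂ (λ D E ω → D ω Bool.∨ E ω)
          (⟦translate⟧ w r (λ Z → m Z ∘ inj₁) U≢V (λ Z → pk Z ∘ inj₁))
          (⟦translate⟧ w′ r′ (λ Z → m Z ∘ inj₂) U≢V (λ Z → pk Z ∘ inj₂))
      ⟦translate⟧ (w ∧ w′) (r , r′) m U≢V pk =
        cong₂ (λ D E ω → D ω Bool.∧ E ω)
          (⟦translate⟧ w r (λ Z → m Z ∘ inj₁) U≢V (λ Z → pk Z ∘ inj₁))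
          (⟦translate⟧ w′ r′ (λ Z → m Z ∘ inj₂) U≢V (λ Z → pk Z ∘ inj₂))
      ⟦translate⟧ (⟨ a ⟩ w) (_ , r) m U≢V pk =
        cong (λ D → ⟪ (λ ω → ∃[ ω′ ] actᴵ a ω ω′ × ω′ ∈ₛ D) ⟫) (⟦translate⟧ w r m U≢V pk)
      ⟦translate⟧ ([ a ] w) (_ , r) m U≢V pk =
        cong (λ D → ⟪ (λ ω → ∀ ω′ → actᴵ a ω ω′ → ω′ ∈ₛ D) ⟫) (⟦translate⟧ w r m U≢V pk)
      ⟦translate⟧ (μ {X} X̄∉ w) r m U≢V {Ω} {Ω′} pk =
        trans (Binder.lfp-pack X X̄∉ w r m U≢V {Ω} {Ω′} pk) (sym (⟦assign⟧ controls (bit X) _ Ω′))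
      ⟦translate⟧ (ν {X} X̄∉ w) r m U≢V {Ω} {Ω′} pk =
        trans (Binder.gfp-pack X X̄∉ w r m U≢V {Ω} {Ω′} pk) (sym (⟦assign⟧ controls (bit X) _ Ω′))

      -- For closed ψ the operator of this outer fixpoint is constant; the
      -- fixpoint only serves to bind U.
      ⟦close-translate⟧ : IsLμFormula ψ → ∀ {U V} → U ≢ V → (Ω : Valuation 𝔄) →
                          ⟦_⟧μ 𝔄 ψ Ω ≡ ⟦_⟧μ 𝔄 (μ plain U ∙ translate U V ψ) Ω
      ⟦close-translate⟧ (w , closed) {U} {V} U≢V Ω = ⊆ₛ-antisym
        (λ ω t → does⁺ λ D p → p ω (subst (ω ∈ₛ_) (const D) t))
        (lfp-least {F = λ D → ⟦_⟧μ 𝔄 (translate U V ψ) (updateᵛ 𝔄 Ω (plain U) D)}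
          (λ ω → subst (ω ∈ₛ_) (sym (const _))))
        where
        const : ∀ D → ⟦_⟧μ 𝔄 ψ Ω ≡ ⟦_⟧μ 𝔄 (translate U V ψ) (updateᵛ 𝔄 Ω (plain U) D)
        -- As `ψ` is closed, every `D` packs `Ω` vacuously.
        const D = ⟦translate⟧ w (respects-agreeOff da ψ fresh (proj₁ av)) (λ _ → id) U≢V
          λ Z f → ⊥-elim (closed Z f)

  -- Codings from control variables.

  controls⇒coding : {L : Signature} {𝒳 𝒱 : Set} {da : DeterministicAssignments L 𝒳}
                    {ψ : Formula L 𝒳 𝒱} → Controls da ψ → Coding da ψ
  controls⇒coding (single y y∉ψ c) = record
    { controls = y ∷ []
    ; pivot    = λ _ → y
    ; bit      = λ X _ → c X
    ; fresh    = λ { (here refl) → y∉ψ }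
    ; pivot∈   = λ _ → here refl
    }
  controls⇒coding {da = da} {ψ} (family x x∉ψ x-inj) = record
    { controls = map x (pvars ψ)
    ; pivot    = x
    -- One-hot code: the control variable of `X` gets `𝟏`, all others `𝟎`.
    ; bit      = λ X → (λ _ → 𝟎) [ x X ↦ 𝟏 ]
    ; fresh    = λ y∈ → case ∈-map⁻ x y∈ of λ where
        (X , X∈ , refl) → x∉ψ X (∈pvars⇒mentionedIn ψ X∈)
    ; pivot∈   = λ m → ∈-map⁺ x (mentionedIn⇒∈pvars ψ m)
    }
    where open DeterministicAssignments da

  coding-available : {L : Signature} {𝒳 𝒱 : Set} {da : DeterministicAssignments L 𝒳}
                     {ψ : Formula L 𝒳 𝒱} (𝔄 : Structure L 𝒳) → IsAssignmentStructure 𝔄 da →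
                     (κ : Controls da ψ) → ControlsAvailable 𝔄 κ →
                     CodingAvailable 𝔄 (controls⇒coding κ)
  coding-available 𝔄 as (single y y∉ψ c) (ind , c-inj) =
    (λ { (here refl) → ind _ }) , λ mX mY → c-inj _ _ mX mY
  coding-available {da = da} {ψ} 𝔄 as (family x x∉ψ x-inj) ind =
    (λ y∈ a∈ → case ∈-map⁻ x y∈ of λ where
      (X , X∈ , refl) → ind X (∈pvars⇒mentionedIn ψ X∈) _ a∈) ,
    λ {X} {Y} mX mY X≢Y → distinct X Y (λ eq → X≢Y (sym (x-inj Y X mY mX eq)))
    where
    open DeterministicAssignments da
    open Structure 𝔄
    distinct : ∀ X Y → x Y ≢ x X →
               funcᴵ (((λ _ → 𝟎) [ x X ↦ 𝟏 ]) (x Y)) [] ≢ funcᴵ (((λ _ → 𝟎) [ x Y ↦ 𝟏 ]) (x Y)) []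
    -- At the control variable of `Y` the code of `X` has `𝟎` and that of `Y` has `𝟏`.
    distinct X Y ne rewrite update-≢ (λ _ → 𝟎) 𝟏 ne | update-≡ (λ _ → 𝟎) (x Y) 𝟏 = proj₁ as

mainTheorem2 : (em : ExcludedMiddle 0ℓ) → Extensionality 0ℓ 0ℓ →
    let open Semantics em in
    (𝒳 𝒱 : Set) → Infinite 𝒳 →
    (L : Signature) (da : DeterministicAssignments L 𝒳) →
    (ψ : Formula L 𝒳 𝒱) → IsLμFormula ψ → (κ : Controls da ψ) →
    ∃[ ψ′ ] IsLμFormula ψ′ × AtMostTwoPVars ψ′ ×
    ((𝔄 : Structure L 𝒳) → IsAssignmentStructure 𝔄 da →
    ControlsAvailable 𝔄 κ →
    (Ω : Valuation 𝔄) → ⟦_⟧μ 𝔄 ψ Ω ≡ ⟦_⟧μ 𝔄 ψ′ Ω)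
-- The translation requires two distinct elements of `𝒱`. Otherwise at most one variable and its
-- complement exist, and `ψ` itself serves.
mainTheorem2 em ext 𝒳 𝒱 _ L da ψ ψ-Lμ κ with em {∃₂ λ (U V : 𝒱) → U ≢ V}
... | yes (U , V , U≢V) =
    (μ plain U ∙ translate U V ψ) ,
    (μ (compl∉translate ψ) (wellFormed-translate U V (proj₁ ψ-Lμ)) ,
      λ { X (X≢U , f) → X≢U (freeIn-translate ψ f) }) ,
    (plain U ∷ plain V ∷ [] , s≤s (s≤s z≤n) , λ where
      X (inj₁ eq) → here eq
      X (inj₂ m)  → case mentionedIn-translate ψ m of λ where
        (inj₁ eq) → here eq
        (inj₂ eq) → there (here eq)) ,
    λ 𝔄 as av Ω → ⟦close-translate⟧ 𝔄 da as (controls⇒coding κ)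
      (coding-available 𝔄 as κ av) ψ-Lμ U≢V Ω
  where
  open Soundness em ext
  open Translation da (controls⇒coding κ)
... | no 𝒱-subsingleton = ψ , ψ-Lμ , two (pvars ψ) (λ X → mentionedIn⇒∈pvars ψ) , λ _ _ _ _ → refl
  where
  ≡-base : ∀ (U V : 𝒱) → U ≡ V
  ≡-base U V with em {U ≡ V}
  ... | yes eq = eq
  ... | no  ne = contradiction (U , V , ne) 𝒱-subsingleton
  ∈-pair : ∀ (U : 𝒱) X → X ∈ plain U ∷ compl U ∷ []
  ∈-pair U (plain V) = here (cong plain (≡-base V U))
  ∈-pair U (compl V) = there (here (cong compl (≡-base V U)))
  two : ∀ Xs → (∀ X → X mentionedIn ψ → X ∈ Xs) → AtMostTwoPVars ψ
  -- `𝒱` may be empty, so an element of it is taken from an occurrence in `ψ`, if there is one.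
  two []            h = [] , z≤n , h
  two (plain U ∷ _) h = plain U ∷ compl U ∷ [] , s≤s (s≤s z≤n) , λ X _ → ∈-pair U X
  two (compl U ∷ _) h = plain U ∷ compl U ∷ [] , s≤s (s≤s z≤n) , λ X _ → ∈-pair U X
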